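{- Let $M$ be a positive integer and let $a$ and $r$ be nonnegative integers. Put $B_M:=\operatorname{lcm}(1,3,5,\dots,2M-1)$. Then $$\sum_{N=0}^{\infty} p\!\left(\left\lfloor\frac{(2M-1)N}{2}\right\rfloor-(B_M a+r),\,2M-1,\,N\right)z^{N}=\frac{\mathrm{Num}_o(M,r)}{(1-z)\,(z^2;z^2)_{2M-2}},$$ where $$\mathrm{Num}_o(M,r)=\sum_{j=1}^M(-1)^{M-j}\,z^{2B_M a/(2j-1)}\, S_{2j-1}\!\left(z^{\,2r+2\binom{M-j+1}{2}}\,\frac{(1-z^{2j-1})\,\bigl(z^{2(2j-1)};z^{2(2j-1)}\bigr)_{2M-2}}{(1-z)\,(z^4;z^2)_{2M-2}}\begin{bmatrix}2M-1\\ M-j\end{bmatrix}_{z^2}\right).$$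
   Context: For an indeterminate $x$ and a nonnegative integer $k$, $(x;q)_k:=(1-x)(1-xq)\cdots(1-xq^{k-1})$ with $(x;q)_0:=1$. The Gaussian polynomial is $\begin{bmatrix}N+m\\ m\end{bmatrix}_q=\frac{(q;q)_{N+m}}{(q;q)_m(q;q)_N}$ for $m,N\ge0$. For integers $n$ and $m,N\ge0$, $p(n,m,N)$ is the number of partitions of $n$ into at most $m$ parts, each part at most $N$; equivalently the coefficient of $q^n$ in $\begin{bmatrix}N+m\\ m\end{bmatrix}_q$ (it is $0$ for $n<0$). For a polynomial $P(z)=\sum_{i=0}^d a_iz^i$ and positive integer $s$, $(S_sP)(z):=\sum_{i=0}^{\lfloor d/s\rfloor}a_{is}z^i$ (the expression inside $S_{2j-1}$ above is a polynomial in $z$). -}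

module Defs where

open import Data.Nat as ℕ using (ℕ; zero; suc; _∸_; _≟_)
open import Data.Nat.Divisibility using (_∣?_; divides)
open import Data.Nat.LCM using (lcm)
open import Data.Integer as ℤ using (ℤ; +_; -[1+_]; _<_)
open import Relation.Nullary using (yes; no)
open import Data.Integer.Properties using (_<?_)

-- Formal power series over ℤ in one variable z, as coefficient functions.
Ser : Set
Ser = ℕ → ℤ

sumTo : ℕ → (ℕ → ℤ) → ℤ
sumTo zero    f = + 0
sumTo (suc n) f = sumTo n f ℤ.+ f n

infixl 7 _⊛_
_⊛_ : Ser → Ser → Ser
(f ⊛ g) n = sumTo (suc n) (λ k → f k ℤ.* g (n ∸ k))

infixl 6 _⊕_
_⊕_ : Ser → Ser → Ser
(f ⊕ g) n = f n ℤ.+ g n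

_·_ : ℤ → Ser → Ser
(c · f) n = c ℤ.* f n

zeroS : Ser
zeroS _ = + 0

X : ℕ → Ser
X e n with n ≟ e
... | yes _ = + 1
... | no  _ = + 0

oneS : Ser
oneS = X 0

oneMinus : ℕ → Ser
oneMinus e n = oneS n ℤ.- X e n

-- 1 / (1 - z^e) = Σ_i z^{e i}   (only used with e ≥ 1)
invOneMinus : ℕ → Ser
invOneMinus e n with e ∣? n
... | yes _ = + 1
... | no  _ = + 0

prodTo : ℕ → (ℕ → Ser) → Ser
prodTo zero    f = oneS
prodTo (suc k) f = prodTo k f ⊛ f k

poch : ℕ → ℕ → ℕ → Ser
poch a b k = prodTo k (λ i → oneMinus (a ℕ.+ i ℕ.* b))

-- 1 / (z^a ; z^b)_k   (only used with a ≥ 1, so every factor is invertible)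
invPoch : ℕ → ℕ → ℕ → Ser
invPoch a b k = prodTo k (λ i → invOneMinus (a ℕ.+ i ℕ.* b))

gauss : ℕ → ℕ → Ser
gauss N m = poch 1 1 (N ℕ.+ m) ⊛ invPoch 1 1 m ⊛ invPoch 1 1 N

atPow : ℕ → Ser → Ser
atPow s f n with s ∣? n
... | yes (divides q _) = f q
... | no  _             = + 0

S : ℕ → Ser → Ser
S s f i = f (s ℕ.* i)

p : ℤ → ℕ → ℕ → ℤ
p (+ n)    m N = gauss N m n
p -[1+ _ ] m N = + 0

B : ℕ → ℕ
B zero    = 1
B (suc k) = lcm (B k) (suc (2 ℕ.* k))

sgn : ℕ → ℤ
sgn k = -[1+ 0 ] ℤ.^ k

sumSer : ℕ → (ℕ → Ser) → Ser
sumSer zero    f = zeroS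
sumSer (suc n) f = sumSer n f ⊕ f n

-- Num_o(M, r), summation index j = suc i (i = 0..M-1), so 2j-1 = suc (2 i)
NumO : ℕ → ℕ → ℕ → Ser
NumO M a r = sumSer M λ i →
  let j = suc i
      o = suc (2 ℕ.* i)
  in sgn (M ∸ j) ·
       (X ((2 ℕ.* B M ℕ.* a) ℕ./ o) ⊛
        S o ( X (2 ℕ.* r ℕ.+ 2 ℕ.* ((M ∸ j ℕ.+ 1) C 2))
            ⊛ oneMinus o
            ⊛ poch (2 ℕ.* o) (2 ℕ.* o) (2 ℕ.* M ∸ 2)
            ⊛ invOneMinus 1
            ⊛ invPoch 4 2 (2 ℕ.* M ∸ 2)
            ⊛ atPow 2 (gauss (M ℕ.+ j ∸ 1) (M ∸ j))))
  where open import Data.Nat.Combinatorics using (_C_)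

{-# OPTIONS --safe #-}

-- Write m = 2M-1. The q-binomial theorem applied to [N+m, m] = (q^(N+1);q)_m / (q;q)_m gives
--   p(n, m, N) = Σ_k (-1)^k [q^(n - C(k+1,2) - kN)] [m, k] / (q;q)_m.
-- For n = ⌊mN/2⌋ - (B_M a + r) the terms with k ≥ M vanish, and for k = M-j the exponent is ⌊oN/2⌋ - T
-- with o = 2j-1 and T independent of N. The coefficient of q^⌊n/2⌋ in G(q) is that of z^n in (1+z) G(z²),
-- so each term is a section S_o; the denominator then comes out through S_o(f · g(z^o)) = S_o(f) · g
-- and (1+z)/(z²;z²)_m = 1/((1-z)(z⁴;z²)_(m-1)).

module Submission where

open import Defs
open import Data.Nat using (ℕ; _≤_; _*_; _+_; _∸_; _/_)
open import Data.Integer using (+_) renaming (_-_ to _-ℤ_)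
open import Relation.Binary.PropositionalEquality using (_≡_)

open import Algebra.Bundles using (CommutativeSemiring)
import Algebra.Structures.Biased as Biased
open import Data.Integer as ℤ using (ℤ; -[1+_])
import Data.Integer.Properties as ℤₚ
open import Data.Integer.Tactic.RingSolver using () renaming (solve-∀ to ℤ-solve)
open import Data.Nat using (zero; suc; _<_; _≟_; z≤n; s≤s)
open import Data.Nat.Combinatorics using (_C_; nCk+nC[k+1]≡[n+1]C[k+1]; nC1≡n)
open import Data.Nat.Divisibility as ∣ₚ
  using (_∣_; _∣?_; divides; ∣-trans; ∣m⇒∣m*n; ∣n⇒∣m*n; ∣-refl; n∣m*n)
import Data.Nat.DivMod as DivMod
open import Data.Nat.LCM using (m∣lcm[m,n]; n∣lcm[m,n])
import Data.Nat.Properties as ℕₚ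
open import Data.Nat.Tactic.RingSolver using () renaming (solve-∀ to ℕ-solve)
open import Data.Product using (∃; _,_)
open import Data.Sum using (_⊎_; inj₁; inj₂)
open import Function using (_∘_)
open import Level using (0ℓ)
open import Algebra.Properties.AbelianGroup ℤₚ.+-0-abelianGroup using (∙-cancelʳ)
open import Relation.Binary.Structures using (IsEquivalence)
open import Relation.Binary.PropositionalEquality
  using (refl; sym; trans; cong; cong₂; subst; module ≡-Reasoning)
open import Relation.Nullary using (Dec; yes; no; ¬_; contradiction)

-- The obstacle is the floor, since ⌊mN/2⌋ is not linear in N. Writing m = o + 2k lets the integer
-- kN leave the floor and cancel the kN in the exponent of the q-binomial term; what is left depends
-- on N only through ⌊oN/2⌋. Since m is odd, o is odd, and it is positive exactly for k < M. For k ≥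
-- M already kN ≥ ⌊mN/2⌋, and C(k+1,2) > 0 pushes the required coefficient below degree 0. The lcm
-- comes from moving a monomial into a section: z^e outside S_o is z^(o e) inside. The shift B_M a
-- becomes 2 B_M a after q = z², so it can stand outside every section only if each o divides 2 B_M
-- a. The quotients [m, k] / (q;q)_m are infinite series, so sections act on arbitrary series; on a
-- polynomial this is the finite sum of the statement. Series are treated as a commutative semiring,
-- and an identity about 1 - z^e is proved by adding z^e back and cancelling.

-- Formal power series

-- Wrapped in a record so that unification recovers the two series without unfolding them.
infix 4 _≈_
record _≈_ (f g : Ser) : Set where
  constructor mk
  field at : ∀ n → f n ≡ g n
open _≈_

≈-isEquivalence : IsEquivalence _≈_
≈-isEquivalence = record
  { refl  = mk λ _ → refl
  ; sym   = λ e → mk λ n → sym (at e n)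
  ; trans = λ d e → mk λ n → trans (at d n) (at e n) }

sumTo-cong : ∀ n {f g : ℕ → ℤ} → (∀ k → k < n → f k ≡ g k) → sumTo n f ≡ sumTo n g
sumTo-cong zero    e = refl
sumTo-cong (suc n) e =
  cong₂ ℤ._+_ (sumTo-cong n λ k k<n → e k (ℕₚ.m<n⇒m<1+n k<n)) (e n ℕₚ.≤-refl)

sumTo-front : ∀ n (f : ℕ → ℤ) → sumTo (suc n) f ≡ f 0 ℤ.+ sumTo n (f ∘ suc)
sumTo-front zero    f = ℤₚ.+-comm (+ 0) (f 0)
sumTo-front (suc n) f =
  trans (cong (ℤ._+ f (suc n)) (sumTo-front n f)) (ℤₚ.+-assoc (f 0) _ _)

tail : Ser → Ser
tail f n = f (suc n)

⊛-cong : ∀ {f f′ g g′} → f ≈ f′ → g ≈ g′ → f ⊛ g ≈ f′ ⊛ g′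
⊛-cong d e = mk λ n → sumTo-cong (suc n) λ k _ → cong₂ ℤ._*_ (at d k) (at e (n ∸ k))

⊛-zero : ∀ f g → (f ⊛ g) 0 ≡ f 0 ℤ.* g 0
⊛-zero f g = ℤₚ.+-identityˡ _

-- With `⊛-sucʳ` this makes the Cauchy product recursive in the coefficient index, so commutativity
-- and associativity become inductions without reindexing of double sums.
⊛-sucˡ : ∀ f g n → (f ⊛ g) (suc n) ≡ f 0 ℤ.* g (suc n) ℤ.+ (tail f ⊛ g) n
⊛-sucˡ f g n = sumTo-front (suc n) _

⊛-sucʳ : ∀ f g n → (f ⊛ g) (suc n) ≡ (f ⊛ tail g) n ℤ.+ f (suc n) ℤ.* g 0
⊛-sucʳ f g n = cong₂ ℤ._+_
  (sumTo-cong (suc n) λ { k (s≤s k≤n) → cong (λ i → f k ℤ.* g i) (ℕₚ.+-∸-assoc 1 k≤n) })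
  (cong (λ i → f (suc n) ℤ.* g i) (ℕₚ.n∸n≡0 n))

⊛-comm : ∀ f g → f ⊛ g ≈ g ⊛ f
⊛-comm f g = mk (go f g)
  where
  go : ∀ f g n → (f ⊛ g) n ≡ (g ⊛ f) n
  go f g zero    = cong (λ x → + 0 ℤ.+ x) (ℤₚ.*-comm (f 0) (g 0))
  go f g (suc n) = begin
    (f ⊛ g) (suc n)                            ≡⟨ ⊛-sucˡ f g n ⟩
    f 0 ℤ.* g (suc n) ℤ.+ (tail f ⊛ g) n       ≡⟨ ℤₚ.+-comm _ ((tail f ⊛ g) n) ⟩
    (tail f ⊛ g) n ℤ.+ f 0 ℤ.* g (suc n)       ≡⟨ cong₂ ℤ._+_ (go (tail f) g n) (ℤₚ.*-comm (f 0) _) ⟩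
    (g ⊛ tail f) n ℤ.+ g (suc n) ℤ.* f 0       ≡⟨ ⊛-sucʳ g f n ⟨
    (g ⊛ f) (suc n)                            ∎
    where open ≡-Reasoning

⊛-distribʳ : ∀ f g h → (g ⊕ h) ⊛ f ≈ (g ⊛ f) ⊕ (h ⊛ f)
⊛-distribʳ f g h = mk λ n → go (suc n) (λ k → n ∸ k)
  where
  step : ∀ a b x y z → a ℤ.+ b ℤ.+ (x ℤ.+ y) ℤ.* z ≡ a ℤ.+ x ℤ.* z ℤ.+ (b ℤ.+ y ℤ.* z)
  step = ℤ-solve
  -- The index map is generalised because `n ∸ k` must keep its `n` while the number of summands
  -- shrinks.
  go : ∀ m (i : ℕ → ℕ) → sumTo m (λ k → (g k ℤ.+ h k) ℤ.* f (i k))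
     ≡ sumTo m (λ k → g k ℤ.* f (i k)) ℤ.+ sumTo m (λ k → h k ℤ.* f (i k))
  go zero    i = refl
  go (suc m) i = trans (cong (ℤ._+ (g m ℤ.+ h m) ℤ.* f (i m)) (go m i)) 
    (step (sumTo m λ k → g k ℤ.* f (i k)) (sumTo m λ k → h k ℤ.* f (i k)) (g m) (h m) (f (i m)))

·-⊛ : ∀ c f g → (c · f) ⊛ g ≈ c · (f ⊛ g)
·-⊛ c f g = mk λ n → go (suc n) (λ k → n ∸ k)
  where
  step : ∀ c a x y → c ℤ.* a ℤ.+ c ℤ.* x ℤ.* y ≡ c ℤ.* (a ℤ.+ x ℤ.* y)
  step = ℤ-solve
  go : ∀ m (i : ℕ → ℕ) → sumTo m (λ k → c ℤ.* f k ℤ.* g (i k)) ≡ c ℤ.* sumTo m (λ k → f k ℤ.* g (i k))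
  go zero    i = sym (ℤₚ.*-zeroʳ c)
  go (suc m) i = trans (cong (ℤ._+ c ℤ.* f m ℤ.* g (i m)) (go m i)) (step c _ (f m) (g (i m)))

-- By `⊛-sucˡ`, the tail of `f ⊛ g` is `(f 0 · tail g) ⊕ (tail f ⊛ g)`; the induction on the
-- coefficient therefore has to let `f` vary.
⊛-assoc : ∀ f g h → (f ⊛ g) ⊛ h ≈ f ⊛ (g ⊛ h)
⊛-assoc f g h = mk (go f)
  where
  open ≡-Reasoning
  step₀ : ∀ a b c → + 0 ℤ.+ a ℤ.* b ℤ.* c ≡ + 0 ℤ.+ a ℤ.* (b ℤ.* c)
  step₀ = ℤ-solve
  step : ∀ a b c x y → a ℤ.* b ℤ.* c ℤ.+ (a ℤ.* x ℤ.+ y) ≡ a ℤ.* (b ℤ.* c ℤ.+ x) ℤ.+ y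
  step = ℤ-solve
  go : ∀ f n → ((f ⊛ g) ⊛ h) n ≡ (f ⊛ (g ⊛ h)) n
  go f zero = begin
    + 0 ℤ.+ (f ⊛ g) 0 ℤ.* h 0         ≡⟨ cong (λ x → + 0 ℤ.+ x ℤ.* h 0) (⊛-zero f g) ⟩
    + 0 ℤ.+ f 0 ℤ.* g 0 ℤ.* h 0       ≡⟨ step₀ (f 0) (g 0) (h 0) ⟩
    + 0 ℤ.+ f 0 ℤ.* (g 0 ℤ.* h 0)     ≡⟨ cong (λ x → + 0 ℤ.+ f 0 ℤ.* x) (⊛-zero g h) ⟨
    + 0 ℤ.+ f 0 ℤ.* (g ⊛ h) 0         ∎
  go f (suc n) = begin
    ((f ⊛ g) ⊛ h) (suc n)
      ≡⟨ ⊛-sucˡ (f ⊛ g) h n ⟩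
    (f ⊛ g) 0 ℤ.* h (suc n) ℤ.+ (tail (f ⊛ g) ⊛ h) n
      ≡⟨ cong₂ ℤ._+_ (cong (ℤ._* h (suc n)) (⊛-zero f g))
           (trans (at (⊛-cong {g = h} (mk (⊛-sucˡ f g)) (mk λ _ → refl)) n)
           (trans (at (⊛-distribʳ h (f 0 · tail g) (tail f ⊛ g)) n)
                  (cong₂ ℤ._+_ (at (·-⊛ (f 0) (tail g) h) n) (go (tail f) n)))) ⟩
    f 0 ℤ.* g 0 ℤ.* h (suc n) ℤ.+ (f 0 ℤ.* (tail g ⊛ h) n ℤ.+ (tail f ⊛ (g ⊛ h)) n)
      ≡⟨ step (f 0) (g 0) (h (suc n)) ((tail g ⊛ h) n) _ ⟩
    f 0 ℤ.* (g 0 ℤ.* h (suc n) ℤ.+ (tail g ⊛ h) n) ℤ.+ (tail f ⊛ (g ⊛ h)) n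
      ≡⟨ cong (λ x → f 0 ℤ.* x ℤ.+ (tail f ⊛ (g ⊛ h)) n) (⊛-sucˡ g h n) ⟨
    f 0 ℤ.* (g ⊛ h) (suc n) ℤ.+ (tail f ⊛ (g ⊛ h)) n
      ≡⟨ ⊛-sucˡ f (g ⊛ h) n ⟨
    (f ⊛ (g ⊛ h)) (suc n) ∎

⊛-zeroˡ : ∀ f → zeroS ⊛ f ≈ zeroS
⊛-zeroˡ f = mk λ n → go (suc n) (λ k → f (n ∸ k))
  where
  go : ∀ m (g : ℕ → ℤ) → sumTo m (λ k → + 0 ℤ.* g k) ≡ + 0
  go zero    g = refl
  go (suc m) g = cong₂ ℤ._+_ (go m g) (ℤₚ.*-zeroˡ (g m))

X-suc : ∀ e → tail (X (suc e)) ≈ X e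
X-suc e = mk go
  where
  go : ∀ n → X (suc e) (suc n) ≡ X e n
  go n with n ≟ e | suc n ≟ suc e
  ... | yes _    | yes _ = refl
  ... | no _     | no _  = refl
  ... | yes refl | no ¬p = contradiction refl ¬p
  ... | no ¬p    | yes refl = contradiction refl ¬p

X-shift-suc : ∀ e f n → (X (suc e) ⊛ f) (suc n) ≡ (X e ⊛ f) n
X-shift-suc e f n = begin
  (X (suc e) ⊛ f) (suc n)                          ≡⟨ ⊛-sucˡ (X (suc e)) f n ⟩
  + 0 ℤ.* f (suc n) ℤ.+ (tail (X (suc e)) ⊛ f) n   ≡⟨ cong₂ ℤ._+_ (ℤₚ.*-zeroˡ (f (suc n)))
                                                        (at (⊛-cong {g = f} (X-suc e) (mk λ _ → refl)) n) ⟩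
  + 0 ℤ.+ (X e ⊛ f) n                              ≡⟨ ℤₚ.+-identityˡ _ ⟩
  (X e ⊛ f) n                                      ∎
  where open ≡-Reasoning

⊛-identityˡ : ∀ f → oneS ⊛ f ≈ f
⊛-identityˡ f = mk go
  where
  open ≡-Reasoning
  go : ∀ n → (oneS ⊛ f) n ≡ f n
  go zero    = trans (ℤₚ.+-identityˡ _) (ℤₚ.*-identityˡ (f 0))
  go (suc n) = begin
    (oneS ⊛ f) (suc n)                             ≡⟨ ⊛-sucˡ oneS f n ⟩
    + 1 ℤ.* f (suc n) ℤ.+ (tail oneS ⊛ f) n        ≡⟨ cong₂ ℤ._+_ (ℤₚ.*-identityˡ (f (suc n)))
                                                        (trans (at (⊛-cong {f′ = zeroS} {g = f} (mk λ _ → refl) (mk λ _ → refl)) n)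
                                                               (at (⊛-zeroˡ f) n)) ⟩
    f (suc n) ℤ.+ + 0                              ≡⟨ ℤₚ.+-identityʳ _ ⟩
    f (suc n)                                      ∎

serSemiring : CommutativeSemiring 0ℓ 0ℓ
serSemiring = record
  { Carrier = Ser ; _≈_ = _≈_ ; _+_ = _⊕_ ; _*_ = _⊛_ ; 0# = zeroS ; 1# = oneS
  ; isCommutativeSemiring = Biased.isCommutativeSemiringˡ record
    { +-isCommutativeMonoid = Biased.isCommutativeMonoidˡ record
      { isSemigroup = record
        { isMagma = record { isEquivalence = ≈-isEquivalence
                           ; ∙-cong = λ d e → mk λ n → cong₂ ℤ._+_ (at d n) (at e n) }
        ; assoc = λ f g h → mk λ n → ℤₚ.+-assoc (f n) (g n) (h n) }
      ; identityˡ = λ f → mk λ n → ℤₚ.+-identityˡ (f n)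
      ; comm = λ f g → mk λ n → ℤₚ.+-comm (f n) (g n) }
    ; *-isCommutativeMonoid = Biased.isCommutativeMonoidˡ record
      { isSemigroup = record
        { isMagma = record { isEquivalence = ≈-isEquivalence ; ∙-cong = ⊛-cong }
        ; assoc = ⊛-assoc }
      ; identityˡ = ⊛-identityˡ
      ; comm = ⊛-comm }
    ; distribʳ = ⊛-distribʳ
    ; zeroˡ = ⊛-zeroˡ } }

module R = CommutativeSemiring serSemiring

import Relation.Binary.Reasoning.Setoid R.setoid as ≈-Reasoning

-- Over an abstract semiring the solver's normal forms stay small; over Ser they unfold to nested sums.
module Rearrangements {c ℓ} (A : CommutativeSemiring c ℓ) where
  open CommutativeSemiring A renaming (refl to ≈-refl; trans to ≈-trans; _≈_ to _≃_; _+_ to _∔_; _*_ to _∙_)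
  open import Algebra.Solver.Ring.NaturalCoefficients.Default A using (solve; _:=_; _:+_; _:*_)
  open import Relation.Binary.Reasoning.Setoid setoid

  cancel-factors : ∀ Q I J x y z u v → x ∙ u ≃ 1# → y ∙ v ≃ 1# →
    Q ∙ (y ∔ z ∙ x) ∙ (J ∙ v) ∙ (I ∙ u) ≃ Q ∙ J ∙ (I ∙ u) ∔ z ∙ (Q ∙ (J ∙ v) ∙ I)
  cancel-factors Q I J x y z u v xu yv = begin
    Q ∙ (y ∔ z ∙ x) ∙ (J ∙ v) ∙ (I ∙ u)
      ≈⟨ solve 8 (λ Q I J x y z u v → Q :* (y :+ z :* x) :* (J :* v) :* (I :* u)
                    := (y :* v) :* (Q :* J :* (I :* u)) :+ z :* ((x :* u) :* (Q :* (J :* v) :* I)))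
           ≈-refl Q I J x y z u v ⟩
    (y ∙ v) ∙ (Q ∙ J ∙ (I ∙ u)) ∔ z ∙ ((x ∙ u) ∙ (Q ∙ (J ∙ v) ∙ I))
      ≈⟨ +-cong (≈-trans (*-congʳ yv) (*-identityˡ _)) (*-congˡ (≈-trans (*-congʳ xu) (*-identityˡ _))) ⟩
    Q ∙ J ∙ (I ∙ u) ∔ z ∙ (Q ∙ (J ∙ v) ∙ I) ∎

  ∔-interchange : ∀ a b x y → (a ∔ b) ∔ (x ∔ y) ≃ (a ∔ x) ∔ (b ∔ y)
  ∔-interchange = solve 4 (λ a b x y → (a :+ b) :+ (x :+ y) := (a :+ x) :+ (b :+ y)) ≈-refl

  ∙-interchange : ∀ a b x y → (a ∙ b) ∙ (x ∙ y) ≃ (a ∙ x) ∙ (b ∙ y)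
  ∙-interchange = solve 4 (λ a b x y → (a :* b) :* (x :* y) := (a :* x) :* (b :* y)) ≈-refl

  ∙-exchange : ∀ a b x y → a ∙ b ∙ (x ∙ y) ≃ (x ∙ a) ∙ (b ∙ y)
  ∙-exchange = solve 4 (λ a b x y → a :* b :* (x :* y) := (x :* a) :* (b :* y)) ≈-refl

  pair-first-last : ∀ Q P I J → Q ∙ P ∙ I ∙ J ≃ (Q ∙ J) ∙ (P ∙ I)
  pair-first-last = solve 4 (λ Q P I J → Q :* P :* I :* J := (Q :* J) :* (P :* I)) ≈-refl

  dilated-factors-last : ∀ x u P v I g → x ∙ u ∙ P ∙ v ∙ I ∙ g ≃ x ∙ v ∙ I ∙ g ∙ u ∙ P
  dilated-factors-last =
    solve 6 (λ x u P v I g → x :* u :* P :* v :* I :* g := x :* v :* I :* g :* u :* P) ≈-refl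

  pair-inverses : ∀ x w u P v I → x ∙ (w ∙ u ∙ P) ∙ v ∙ I ≃ (u ∙ v) ∙ ((P ∙ I) ∙ (x ∙ w))
  pair-inverses =
    solve 6 (λ x w u P v I → x :* (w :* u :* P) :* v :* I := (u :* v) :* ((P :* I) :* (x :* w))) ≈-refl

  pair-inverses′ : ∀ x v I a w P → x ∙ v ∙ I ∙ (a ∙ (w ∙ P)) ≃ (P ∙ I) ∙ ((w ∙ v) ∙ (x ∙ a))
  pair-inverses′ =
    solve 6 (λ x v I a w P → x :* v :* I :* (a :* (w :* P)) := (P :* I) :* ((w :* v) :* (x :* a))) ≈-refl

  move-into : ∀ x y z a → x ∙ (y ∙ (z ∙ a)) ≃ y ∙ (x ∙ z ∙ a)
  move-into = solve 4 (λ x y z a → x :* (y :* (z :* a)) := y :* (x :* z :* a)) ≈-refl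

  ∙-left-comm : ∀ x s i → x ∙ (s ∙ i) ≃ s ∙ (x ∙ i)
  ∙-left-comm = solve 3 (λ x s i → x :* (s :* i) := s :* (x :* i)) ≈-refl

  one-plus-factor : ∀ u x v → (u ∔ x ∙ u) ∙ v ≃ u ∙ v ∔ x ∙ (u ∙ v)
  one-plus-factor = solve 3 (λ u x v → (u :+ x :* u) :* v := u :* v :+ x :* (u :* v)) ≈-refl

  factor-left : ∀ f m x → f ∙ m ∔ x ∙ f ≃ f ∙ (m ∔ x)
  factor-left = solve 3 (λ f m x → f :* m :+ x :* f := f :* (m :+ x)) ≈-refl

open Rearrangements serSemiring

⊛-congˡ : ∀ f {g h} → g ≈ h → f ⊛ g ≈ f ⊛ h
⊛-congˡ f = ⊛-cong (R.refl {f})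

⊛-congʳ : ∀ h {f g} → f ≈ g → f ⊛ h ≈ g ⊛ h
⊛-congʳ h e = ⊛-cong e (R.refl {h})

⊕-cong : ∀ {f f′ g g′} → f ≈ f′ → g ≈ g′ → f ⊕ g ≈ f′ ⊕ g′
⊕-cong = R.+-cong

⊕-congˡ : ∀ f {g h} → g ≈ h → f ⊕ g ≈ f ⊕ h
⊕-congˡ f = ⊕-cong (R.refl {f})

⊕-cancelʳ : ∀ {f g} h → f ⊕ h ≈ g ⊕ h → f ≈ g
⊕-cancelʳ h e = mk λ n → ∙-cancelʳ (h n) _ _ (at e n)

-- Monomials and the inverse of 1 - z^e

below-or-shift : ∀ e n → n < e ⊎ ∃ λ d → n ≡ e + d
below-or-shift e n with n ℕₚ.<? e
... | yes n<e = inj₁ n<e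
... | no  n≮e = inj₂ (n ∸ e , sym (ℕₚ.m+[n∸m]≡n (ℕₚ.≮⇒≥ n≮e)))

X-shift : ∀ e f n → (X e ⊛ f) (e + n) ≡ f n
X-shift zero    f n = at (R.*-identityˡ f) n
X-shift (suc e) f n = trans (X-shift-suc e f (e + n)) (X-shift e f n)

X-below : ∀ e f n → n < e → (X e ⊛ f) n ≡ + 0
X-below (suc e) f zero    _         = trans (⊛-zero (X (suc e)) f) (ℤₚ.*-zeroˡ (f 0))
X-below (suc e) f (suc n) (s≤s n<e) = trans (X-shift-suc e f n) (X-below e f n n<e)

X-+ : ∀ a b → X a ⊛ X b ≈ X (a + b)
X-+ zero    b = R.*-identityˡ (X b)
X-+ (suc a) b = mk λ
  { zero    → X-below (suc a) (X b) 0 (s≤s z≤n)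
  ; (suc n) → trans (X-shift-suc a (X b) n) (trans (at (X-+ a b) n) (sym (at (X-suc (a + b)) n))) }

X-shift-+ : ∀ e d f n → (X (d + e) ⊛ f) (d + n) ≡ (X e ⊛ f) n
X-shift-+ e d f n = trans
  (at (R.trans (⊛-congʳ f (R.sym (X-+ d e))) (R.*-assoc (X d) (X e) f)) (d + n))
  (X-shift d (X e ⊛ f) n)

oneMinus⊕X : ∀ e → oneMinus e ⊕ X e ≈ oneS
oneMinus⊕X e = mk λ n → eq (oneS n) (X e n)
  where
  eq : ∀ x y → x ℤ.- y ℤ.+ y ≡ x
  eq = ℤ-solve

-- Determines `f ⊛ oneMinus e` by an equation without subtraction. Any additive operator that
-- respects monomial shifts can be applied to it, which is how `Dilation` handles the factors 1 -
-- z^e.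
⊛-oneMinus : ∀ f e → f ⊛ oneMinus e ⊕ X e ⊛ f ≈ f
⊛-oneMinus f e = begin
  f ⊛ oneMinus e ⊕ X e ⊛ f   ≈⟨ factor-left f (oneMinus e) (X e) ⟩
  f ⊛ (oneMinus e ⊕ X e)     ≈⟨ ⊛-congˡ f (oneMinus⊕X e) ⟩
  f ⊛ oneS                   ≈⟨ R.*-identityʳ f ⟩
  f                          ∎
  where open ≈-Reasoning

oneMinus-+ : ∀ a b → oneMinus (a + b) ≈ oneMinus a ⊕ X a ⊛ oneMinus b
oneMinus-+ a b = ⊕-cancelʳ (X (a + b)) (begin
  oneMinus (a + b) ⊕ X (a + b)                  ≈⟨ oneMinus⊕X (a + b) ⟩
  oneS                                          ≈⟨ oneMinus⊕X a ⟨
  oneMinus a ⊕ X a                              ≈⟨ ⊕-congˡ (oneMinus a) (⊛-oneMinus (X a) b) ⟨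
  oneMinus a ⊕ (X a ⊛ oneMinus b ⊕ X b ⊛ X a)   ≈⟨ ⊕-congˡ (oneMinus a) (⊕-congˡ (X a ⊛ oneMinus b) (R.trans (R.*-comm (X b) (X a)) (X-+ a b))) ⟩
  oneMinus a ⊕ (X a ⊛ oneMinus b ⊕ X (a + b))   ≈⟨ R.+-assoc (oneMinus a) (X a ⊛ oneMinus b) (X (a + b)) ⟨
  oneMinus a ⊕ X a ⊛ oneMinus b ⊕ X (a + b)     ∎)
  where open ≈-Reasoning

invOneMinus-shift : ∀ e n → invOneMinus (suc e) (suc e + n) ≡ invOneMinus (suc e) n
invOneMinus-shift e n with suc e ∣? (suc e + n) | suc e ∣? n
... | yes _ | yes _ = refl
... | no  _ | no  _ = refl
... | yes d | no ¬d = contradiction (∣ₚ.∣m+n∣m⇒∣n d ∣-refl) ¬d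
... | no ¬d | yes d = contradiction (∣ₚ.∣m∣n⇒∣m+n ∣-refl d) ¬d

invOneMinus-below : ∀ e n → n < suc e → invOneMinus (suc e) n ≡ oneS n
invOneMinus-below e zero    _ with suc e ∣? 0
... | yes _ = refl
... | no ¬d = contradiction (suc e ∣ₚ.∣0) ¬d
invOneMinus-below e (suc n) n<e with suc e ∣? suc n
... | yes d = contradiction d (∣ₚ.>⇒∤ n<e)
... | no  _ = refl

-- Up to the exponent the coefficients are those of 1, and from there they repeat with that period:
-- the functional equation of the geometric series.
invOneMinus-unfold : ∀ e → invOneMinus (suc e) ≈ oneS ⊕ X (suc e) ⊛ invOneMinus (suc e)
invOneMinus-unfold e = mk λ n → go n (below-or-shift (suc e) n)
  where
  inv = invOneMinus (suc e)
  go : ∀ n → n < suc e ⊎ (∃ λ d → n ≡ suc e + d) → inv n ≡ oneS n ℤ.+ (X (suc e) ⊛ inv) n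
  go n (inj₁ n<e) = sym (trans (cong (λ x → oneS n ℤ.+ x) (X-below (suc e) inv n n<e))
                        (trans (ℤₚ.+-identityʳ (oneS n)) (sym (invOneMinus-below e n n<e))))
  go .(suc e + d) (inj₂ (d , refl)) = trans (invOneMinus-shift e d)
    (sym (trans (ℤₚ.+-identityˡ _) (X-shift (suc e) inv d)))

oneMinus-inverse : ∀ e → oneMinus (suc e) ⊛ invOneMinus (suc e) ≈ oneS
oneMinus-inverse e = ⊕-cancelʳ (X (suc e) ⊛ inv) (begin
  oneMinus (suc e) ⊛ inv ⊕ X (suc e) ⊛ inv   ≈⟨ R.distribʳ inv (oneMinus (suc e)) (X (suc e)) ⟨
  (oneMinus (suc e) ⊕ X (suc e)) ⊛ inv       ≈⟨ ⊛-congʳ inv (oneMinus⊕X (suc e)) ⟩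
  oneS ⊛ inv                                 ≈⟨ R.*-identityˡ inv ⟩
  inv                                        ≈⟨ invOneMinus-unfold e ⟩
  oneS ⊕ X (suc e) ⊛ inv                     ∎)
  where
  inv = invOneMinus (suc e)
  open ≈-Reasoning

-- Finite products and q-shifted factorials

prodTo-cong : ∀ k {f g} → (∀ i → f i ≈ g i) → prodTo k f ≈ prodTo k g
prodTo-cong zero    e = R.refl
prodTo-cong (suc k) e = ⊛-cong (prodTo-cong k e) (e k)

prodTo-front : ∀ k f → prodTo (suc k) f ≈ f 0 ⊛ prodTo k (f ∘ suc)
prodTo-front zero    f = R.*-comm oneS (f 0)
prodTo-front (suc k) f = R.trans (⊛-congʳ (f (suc k)) (prodTo-front k f)) (R.*-assoc (f 0) (prodTo k (f ∘ suc)) (f (suc k)))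

prodTo-+ : ∀ j k f → prodTo (j + k) f ≈ prodTo j f ⊛ prodTo k (λ i → f (j + i))
prodTo-+ j zero    f rewrite ℕₚ.+-identityʳ j = R.sym (R.*-identityʳ _)
prodTo-+ j (suc k) f rewrite ℕₚ.+-suc j k =
  R.trans (⊛-congʳ (f (j + k)) (prodTo-+ j k f))
    (R.*-assoc (prodTo j f) (prodTo k λ i → f (j + i)) (f (j + k)))

poch-front : ∀ a b k → poch a b (suc k) ≈ oneMinus a ⊛ poch (a + b) b k
poch-front a b k = R.trans (prodTo-front k _) (⊛-cong
  (R.reflexive (cong oneMinus (ℕₚ.+-identityʳ a)))
  (prodTo-cong k λ i → R.reflexive (cong oneMinus (sym (ℕₚ.+-assoc a b (i * b))))))

poch-+ : ∀ N m → poch 1 1 (N + m) ≈ poch 1 1 N ⊛ poch (suc N) 1 m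
poch-+ N m = R.trans (prodTo-+ N m _) (⊛-congˡ (poch 1 1 N)
  (prodTo-cong m λ i → R.reflexive (cong oneMinus (cong suc (eq N i)))))
  where
  eq : ∀ N i → (N + i) * 1 ≡ N + i * 1
  eq = ℕ-solve

poch-inverse : ∀ a b k → poch (suc a) b k ⊛ invPoch (suc a) b k ≈ oneS
poch-inverse a b zero    = R.*-identityˡ oneS
poch-inverse a b (suc k) = begin
  (P ⊛ u) ⊛ (I ⊛ v)   ≈⟨ ∙-interchange P u I v ⟩
  (P ⊛ I) ⊛ (u ⊛ v)   ≈⟨ ⊛-cong (poch-inverse a b k) (oneMinus-inverse (a + k * b)) ⟩
  oneS ⊛ oneS         ≈⟨ R.*-identityˡ oneS ⟩
  oneS                ∎
  where
  P = poch (suc a) b k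
  I = invPoch (suc a) b k
  u = oneMinus (suc a + k * b)
  v = invOneMinus (suc a + k * b)
  open ≈-Reasoning

-- Dilations and sections

-- Additive operators that turn multiplication by z^(α e) into multiplication by z^(β e):
-- atPow s (α = id, β = s ·) and the section S s (α = s ·, β = id).
module Dilation
  (T : Ser → Ser) (α β : ℕ → ℕ)
  (T-cong : ∀ {f g} → f ≈ g → T f ≈ T g)
  (T-⊕ : ∀ f g → T (f ⊕ g) ≈ T f ⊕ T g)
  (T-X : ∀ e f → T (X (α e) ⊛ f) ≈ X (β e) ⊛ T f)
  (α-affine : ∀ a b i → α (a + i * b) ≡ α a + i * α b)
  (β-affine : ∀ a b i → β (a + i * b) ≡ β a + i * β b)
  where

  T-oneMinus : ∀ f e → T (f ⊛ oneMinus (α e)) ≈ T f ⊛ oneMinus (β e)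
  T-oneMinus f e = ⊕-cancelʳ (X (β e) ⊛ T f) (begin
    T (f ⊛ oneMinus (α e)) ⊕ X (β e) ⊛ T f       ≈⟨ ⊕-congˡ (T (f ⊛ oneMinus (α e))) (T-X e f) ⟨
    T (f ⊛ oneMinus (α e)) ⊕ T (X (α e) ⊛ f)     ≈⟨ T-⊕ (f ⊛ oneMinus (α e)) (X (α e) ⊛ f) ⟨
    T (f ⊛ oneMinus (α e) ⊕ X (α e) ⊛ f)         ≈⟨ T-cong (⊛-oneMinus f (α e)) ⟩
    T f                                          ≈⟨ ⊛-oneMinus (T f) (β e) ⟨
    T f ⊛ oneMinus (β e) ⊕ X (β e) ⊛ T f         ∎)
    where open ≈-Reasoning

  T-poch : ∀ f a b k → T (f ⊛ poch (α a) (α b) k) ≈ T f ⊛ poch (β a) (β b) k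
  T-poch f a b zero    = R.trans (T-cong (R.*-identityʳ f)) (R.sym (R.*-identityʳ (T f)))
  T-poch f a b (suc k) = begin
    T (f ⊛ (poch (α a) (α b) k ⊛ oneMinus (α a + k * α b)))
      ≈⟨ T-cong (R.*-assoc f (poch (α a) (α b) k) (oneMinus (α a + k * α b))) ⟨
    T (f ⊛ poch (α a) (α b) k ⊛ oneMinus (α a + k * α b))
      ≡⟨ cong (λ e → T (f ⊛ poch (α a) (α b) k ⊛ oneMinus e)) (α-affine a b k) ⟨
    T (f ⊛ poch (α a) (α b) k ⊛ oneMinus (α (a + k * b)))
      ≈⟨ T-oneMinus (f ⊛ poch (α a) (α b) k) (a + k * b) ⟩
    T (f ⊛ poch (α a) (α b) k) ⊛ oneMinus (β (a + k * b))
      ≡⟨ cong (λ e → T (f ⊛ poch (α a) (α b) k) ⊛ oneMinus e) (β-affine a b k) ⟩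
    T (f ⊛ poch (α a) (α b) k) ⊛ oneMinus (β a + k * β b)
      ≈⟨ ⊛-congʳ (oneMinus (β a + k * β b)) (T-poch f a b k) ⟩
    T f ⊛ poch (β a) (β b) k ⊛ oneMinus (β a + k * β b)
      ≈⟨ R.*-assoc (T f) (poch (β a) (β b) k) (oneMinus (β a + k * β b)) ⟩
    T f ⊛ (poch (β a) (β b) k ⊛ oneMinus (β a + k * β b)) ∎
    where open ≈-Reasoning

*-affine : ∀ s a b i → s * (a + i * b) ≡ s * a + i * (s * b)
*-affine = ℕ-solve

S-cong : ∀ s {f g} → f ≈ g → S s f ≈ S s g
S-cong s e = mk λ n → at e (s * n)

S-X : ∀ s e f → S (suc s) (X (suc s * e) ⊛ f) ≈ X e ⊛ S (suc s) f
S-X s e f = mk λ n → go n (below-or-shift e n)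
  where
  go : ∀ n → n < e ⊎ (∃ λ d → n ≡ e + d) → S (suc s) (X (suc s * e) ⊛ f) n ≡ (X e ⊛ S (suc s) f) n
  go n (inj₁ n<e) = trans (X-below (suc s * e) f (suc s * n) (ℕₚ.*-monoʳ-< (suc s) n<e))
                          (sym (X-below e (S (suc s) f) n n<e))
  go .(e + d) (inj₂ (d , refl)) = trans
    (trans (cong (X (suc s * e) ⊛ f) (ℕₚ.*-distribˡ-+ (suc s) e d)) (X-shift (suc s * e) f (suc s * d)))
    (sym (X-shift e (S (suc s) f) d))

module S-Dilation s = Dilation (S (suc s)) (suc s *_) (λ e → e) (S-cong (suc s))
  (λ _ _ → R.refl) (S-X s) (*-affine (suc s)) (λ _ _ _ → refl)

atPow-∤ : ∀ s f n → ¬ s ∣ n → atPow s f n ≡ + 0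
atPow-∤ s f n s∤n with s ∣? n
... | yes d = contradiction d s∤n
... | no  _ = refl

atPow-* : ∀ s f q → atPow (suc s) f (q * suc s) ≡ f q
atPow-* s f q with suc s ∣? q * suc s
-- The quotient found by the decision procedure is identified with `q` by cancelling the positive
-- factor.
... | yes (divides q′ e) = cong f (sym (ℕₚ.*-cancelʳ-≡ q q′ (suc s) e))
... | no ¬d = contradiction (n∣m*n q) ¬d

atPow-cong : ∀ s {f g} → f ≈ g → atPow s f ≈ atPow s g
atPow-cong s {f} {g} e = mk go
  where
  go : ∀ n → atPow s f n ≡ atPow s g n
  go n with s ∣? n
  ... | yes (divides q _) = at e q
  ... | no  _             = refl

atPow-⊕ : ∀ s f g → atPow s (f ⊕ g) ≈ atPow s f ⊕ atPow s g
atPow-⊕ s f g = mk go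
  where
  go : ∀ n → atPow s (f ⊕ g) n ≡ atPow s f n ℤ.+ atPow s g n
  go n with s ∣? n
  ... | yes (divides q _) = refl
  ... | no  _             = refl

atPow-X : ∀ s e f → atPow (suc s) (X e ⊛ f) ≈ X (suc s * e) ⊛ atPow (suc s) f
atPow-X s e f = mk λ n → go n (below-or-shift (suc s * e) n)
  where
  go : ∀ n → n < suc s * e ⊎ (∃ λ d → n ≡ suc s * e + d) →
       atPow (suc s) (X e ⊛ f) n ≡ (X (suc s * e) ⊛ atPow (suc s) f) n
  go n (inj₁ n<se) = trans (vanish (suc s ∣? n)) (sym (X-below (suc s * e) (atPow (suc s) f) n n<se))
    where
    vanish : Dec (suc s ∣ n) → atPow (suc s) (X e ⊛ f) n ≡ + 0
    vanish (yes (divides q refl)) = trans (atPow-* s (X e ⊛ f) q)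
      (X-below e f q (ℕₚ.*-cancelˡ-< (suc s) q e (subst (_< suc s * e) (ℕₚ.*-comm q (suc s)) n<se)))
    vanish (no s∤n) = atPow-∤ (suc s) (X e ⊛ f) n s∤n
  go .(suc s * e + d) (inj₂ (d , refl)) = trans (shift (suc s ∣? d)) (sym (X-shift (suc s * e) (atPow (suc s) f) d))
    where
    shift : Dec (suc s ∣ d) → atPow (suc s) (X e ⊛ f) (suc s * e + d) ≡ atPow (suc s) f d
    shift (yes (divides q refl)) = begin
      atPow (suc s) (X e ⊛ f) (suc s * e + q * suc s)
        ≡⟨ cong (λ i → atPow (suc s) (X e ⊛ f) (i + q * suc s)) (ℕₚ.*-comm (suc s) e) ⟩
      atPow (suc s) (X e ⊛ f) (e * suc s + q * suc s)
        ≡⟨ cong (atPow (suc s) (X e ⊛ f)) (ℕₚ.*-distribʳ-+ (suc s) e q) ⟨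
      atPow (suc s) (X e ⊛ f) ((e + q) * suc s)         ≡⟨ atPow-* s (X e ⊛ f) (e + q) ⟩
      (X e ⊛ f) (e + q)                                 ≡⟨ X-shift e f q ⟩
      f q                                               ≡⟨ atPow-* s f q ⟨
      atPow (suc s) f (q * suc s)                       ∎
      where open ≡-Reasoning
    shift (no s∤d) = trans
      (atPow-∤ (suc s) (X e ⊛ f) _ λ s∣n → s∤d (∣ₚ.∣m+n∣m⇒∣n s∣n (∣m⇒∣m*n e ∣-refl)))
      (sym (atPow-∤ (suc s) f d s∤d))

module atPow-Dilation s = Dilation (atPow (suc s)) (λ e → e) (suc s *_) (atPow-cong (suc s))
  (atPow-⊕ (suc s)) (atPow-X s) (λ _ _ _ → refl) (*-affine (suc s))

even-or-odd : ∀ n → (∃ λ q → n ≡ q * 2) ⊎ (∃ λ q → n ≡ suc (q * 2))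
even-or-odd zero    = inj₁ (0 , refl)
even-or-odd (suc n) with even-or-odd n
... | inj₁ (q , refl) = inj₂ (q , refl)
... | inj₂ (q , refl) = inj₁ (suc q , refl)

2∤odd : ∀ q → ¬ 2 ∣ suc (q * 2)
2∤odd q d = ∣ₚ.>⇒∤ (s≤s (s≤s z≤n)) (∣ₚ.∣m+n∣m⇒∣n (subst (2 ∣_) (ℕₚ.+-comm 1 (q * 2)) d) (n∣m*n q))

-- Substituting z² leaves the odd positions empty, and the factor 1 + z fills each with the
-- coefficient just before it. So `f q` stands at both 2q and 2q + 1.
atPow2-half : ∀ f n → ((oneS ⊕ X 1) ⊛ atPow 2 f) n ≡ f (n / 2)
atPow2-half f n = trans
  (at (R.trans (R.distribʳ g oneS (X 1)) (R.+-cong (R.*-identityˡ g) (R.refl {X 1 ⊛ g}))) n)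
  (go n (even-or-odd n))
  where
  g = atPow 2 f
  shifted-even : ∀ q → (X 1 ⊛ g) (q * 2) ≡ + 0
  shifted-even zero    = X-below 1 g 0 (s≤s z≤n)
  shifted-even (suc q) = trans (X-shift 1 g (suc (q * 2))) (atPow-∤ 2 f _ (2∤odd q))
  go : ∀ n → (∃ λ q → n ≡ q * 2) ⊎ (∃ λ q → n ≡ suc (q * 2)) → g n ℤ.+ (X 1 ⊛ g) n ≡ f (n / 2)
  go .(q * 2) (inj₁ (q , refl)) = trans (cong₂ ℤ._+_ (atPow-* 1 f q) (shifted-even q))
    (trans (ℤₚ.+-identityʳ (f q)) (cong f (sym (DivMod.m*n/n≡m q 2))))
  go .(suc (q * 2)) (inj₂ (q , refl)) =
    trans (cong₂ ℤ._+_ (atPow-∤ 2 f _ (2∤odd q)) (trans (X-shift 1 g (q * 2)) (atPow-* 1 f q)))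
    (trans (ℤₚ.+-identityˡ (f q))
           (cong f (sym (trans (DivMod.+-distrib-/-∣ʳ 1 {d = 2} (n∣m*n q)) (DivMod.m*n/n≡m q 2)))))

-- Finite sums of series

sumSer-cong : ∀ n {f g} → (∀ k → f k ≈ g k) → sumSer n f ≈ sumSer n g
sumSer-cong zero    e = R.refl
sumSer-cong (suc n) e = ⊕-cong (sumSer-cong n e) (e n)

sumSer-front : ∀ n f → sumSer (suc n) f ≈ f 0 ⊕ sumSer n (f ∘ suc)
sumSer-front zero    f = R.+-comm zeroS (f 0)
sumSer-front (suc n) f =
  R.trans (⊕-cong (sumSer-front n f) (R.refl {f (suc n)})) (R.+-assoc (f 0) (sumSer n (f ∘ suc)) (f (suc n)))

sumSer-⊕ : ∀ n f g → sumSer n (λ k → f k ⊕ g k) ≈ sumSer n f ⊕ sumSer n g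
sumSer-⊕ zero    f g = R.sym (R.+-identityˡ zeroS)
sumSer-⊕ (suc n) f g = R.trans (⊕-cong (sumSer-⊕ n f g) (R.refl {f n ⊕ g n}))
  (∔-interchange (sumSer n f) (sumSer n g) (f n) (g n))

sumSer-⊛ : ∀ n f g → sumSer n f ⊛ g ≈ sumSer n (λ k → f k ⊛ g)
sumSer-⊛ zero    f g = R.zeroˡ g
sumSer-⊛ (suc n) f g = R.trans (R.distribʳ g (sumSer n f) (f n)) (⊕-cong (sumSer-⊛ n f g) (R.refl {f n ⊛ g}))

sumSer-at : ∀ n f i → sumSer n f i ≡ sumTo n (λ k → f k i)
sumSer-at zero    f i = refl
sumSer-at (suc n) f i = cong (ℤ._+ f n i) (sumSer-at n f i)

-- The q-binomial theorem

-- binom m k is [m, k]_q with k beyond m allowed, where it is 0; gauss a b corresponds to binom (a + b) b.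
binom : ℕ → ℕ → Ser
binom m       zero    = oneS
binom zero    (suc k) = zeroS
binom (suc m) (suc k) = binom m k ⊕ X (suc k) ⊛ binom m (suc k)

binom-vanish : ∀ {m k} → m < k → binom m k ≈ zeroS
binom-vanish {zero}  {suc k} _ = R.refl
binom-vanish {suc m} {suc k} (s≤s m<k) = R.trans
  (⊕-cong (binom-vanish m<k) (⊛-congˡ (X (suc k)) (binom-vanish (ℕₚ.m<n⇒m<1+n m<k))))
  (R.trans (R.+-identityˡ (X (suc k) ⊛ zeroS)) (R.zeroʳ (X (suc k))))

-- The last factor of the top factorial splits as 1 - q^(a+b+2) = (1 - q^(b+1)) + q^(b+1) (1 -
-- q^(a+1)), and each part cancels the last factor of one of the two denominators.
gauss-pascal : ∀ a b → gauss (suc a) (suc b) ≈ gauss (suc a) b ⊕ X (suc b) ⊛ gauss a (suc b)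
gauss-pascal a b = begin
  (Q ⊛ oneMinus (suc ((a + suc b) * 1))) ⊛ (J ⊛ v) ⊛ (I ⊛ u)
    ≡⟨ cong (λ e → (Q ⊛ oneMinus e) ⊛ (J ⊛ v) ⊛ (I ⊛ u)) (eq₁ a b) ⟩
  (Q ⊛ oneMinus (suc b * 1 + suc a * 1)) ⊛ (J ⊛ v) ⊛ (I ⊛ u)
    ≈⟨ ⊛-congʳ (I ⊛ u) (⊛-congʳ (J ⊛ v) (⊛-congˡ Q (oneMinus-+ (suc b * 1) (suc a * 1)))) ⟩
  (Q ⊛ (y ⊕ X (suc b * 1) ⊛ x)) ⊛ (J ⊛ v) ⊛ (I ⊛ u)
    ≈⟨ cancel-factors Q I J x y (X (suc b * 1)) u v (oneMinus-inverse (a * 1)) (oneMinus-inverse (b * 1)) ⟩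
  Q ⊛ J ⊛ (I ⊛ u) ⊕ X (suc b * 1) ⊛ (Q ⊛ (J ⊛ v) ⊛ I)
    ≡⟨ cong₂ (λ e i → poch 1 1 i ⊛ J ⊛ (I ⊛ u) ⊕ X e ⊛ (Q ⊛ (J ⊛ v) ⊛ I)) (ℕₚ.*-identityʳ (suc b)) (ℕₚ.+-suc a b) ⟩
  gauss (suc a) b ⊕ X (suc b) ⊛ gauss a (suc b) ∎
  where
  open ≈-Reasoning
  Q = poch 1 1 (a + suc b)
  I = invPoch 1 1 a
  J = invPoch 1 1 b
  -- `suc a * 1` reduces to the exponent `1 + a * 1` of the last factor of `poch 1 1 (suc a)`, so
  -- keeping the `* 1` lets the factorials unfold by computation.
  x = oneMinus (suc a * 1)
  y = oneMinus (suc b * 1)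
  u = invOneMinus (suc a * 1)
  v = invOneMinus (suc b * 1)
  eq₁ : ∀ a b → suc ((a + suc b) * 1) ≡ suc b * 1 + suc a * 1
  eq₁ = ℕ-solve

gauss-0ʳ : ∀ a → gauss a 0 ≈ oneS
gauss-0ʳ a rewrite ℕₚ.+-identityʳ a =
  R.trans (⊛-congʳ (invPoch 1 1 a) (R.*-identityʳ (poch 1 1 a))) (poch-inverse 0 1 a)

gauss-0ˡ : ∀ b → gauss 0 b ≈ oneS
gauss-0ˡ b = R.trans (R.*-identityʳ (poch 1 1 b ⊛ invPoch 1 1 b)) (poch-inverse 0 1 b)

-- Both sides obey the same q-Pascal recurrence, and on the edge a = 0 the extra summand vanishes.
-- This ties the quotient `gauss` to the division-free `binom`, on which the q-binomial theorem is
-- an induction.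
binom-gauss : ∀ a b → binom (a + b) b ≈ gauss a b
binom-gauss a       zero    = R.sym (gauss-0ʳ a)
binom-gauss zero    (suc b) = begin
  binom b b ⊕ X (suc b) ⊛ binom b (suc b)   ≈⟨ ⊕-cong (R.trans (binom-gauss zero b) (gauss-0ˡ b))
                                                 (⊛-congˡ (X (suc b)) (binom-vanish (ℕₚ.n<1+n b))) ⟩
  oneS ⊕ X (suc b) ⊛ zeroS                  ≈⟨ ⊕-congˡ oneS (R.zeroʳ (X (suc b))) ⟩
  oneS ⊕ zeroS                              ≈⟨ R.+-identityʳ oneS ⟩
  oneS                                      ≈⟨ gauss-0ˡ (suc b) ⟨
  gauss 0 (suc b)                           ∎
  where open ≈-Reasoning
binom-gauss (suc a) (suc b) = begin
  binom (a + suc b) b ⊕ X (suc b) ⊛ binom (a + suc b) (suc b)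
    ≡⟨ cong (λ m → binom m b ⊕ X (suc b) ⊛ binom (a + suc b) (suc b)) (ℕₚ.+-suc a b) ⟩
  binom (suc a + b) b ⊕ X (suc b) ⊛ binom (a + suc b) (suc b)
    ≈⟨ ⊕-cong (binom-gauss (suc a) b) (⊛-congˡ (X (suc b)) (binom-gauss a (suc b))) ⟩
  gauss (suc a) b ⊕ X (suc b) ⊛ gauss a (suc b)
    ≈⟨ gauss-pascal a b ⟨
  gauss (suc a) (suc b) ∎
  where open ≈-Reasoning

·-cong : ∀ c {f g} → f ≈ g → c · f ≈ c · g
·-cong c e = mk λ n → cong (c ℤ.*_) (at e n)

⊛-· : ∀ c f g → f ⊛ (c · g) ≈ c · (f ⊛ g)
⊛-· c f g = R.trans (R.*-comm f (c · g)) (R.trans (·-⊛ c g f) (·-cong c (R.*-comm g f)))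

C2-suc : ∀ k → suc (suc k) C 2 ≡ suc k + suc k C 2
C2-suc k = trans (sym (nCk+nC[k+1]≡[n+1]C[k+1] (suc k) 1)) (cong (_+ suc k C 2) (nC1≡n (suc k)))

-- The summands of (q^(N+1);q)_m = Σ_k (-1)^k q^(C(k+1,2) + kN) [m, k]_q.
qTerm : ℕ → ℕ → ℕ → Ser
qTerm N m k = sgn k · (X (suc k C 2 + k * N) ⊛ binom m k)

-- After q-Pascal, the two occurrences of [m, k] carry the same exponent `e` with opposite signs and
-- cancel. The surviving [m, k+1] has exponent `e + suc k`, the one that belongs to N + 1.
qTerm-step : ∀ N m k → qTerm N (suc m) (suc k) ⊕ X (suc N) ⊛ qTerm (suc N) m k ≈ qTerm (suc N) m (suc k)
qTerm-step N m k = begin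
  sgn (suc k) · (X e ⊛ (b ⊕ X (suc k) ⊛ b′)) ⊕ X (suc N) ⊛ (sgn k · (X e₀ ⊛ b))
    ≈⟨ ⊕-cong (·-cong (sgn (suc k)) upper) lower ⟩
  sgn (suc k) · (X e ⊛ b ⊕ X e′ ⊛ b′) ⊕ sgn k · (X e ⊛ b)
    ≈⟨ (mk λ n → eq (sgn k) ((X e ⊛ b) n) ((X e′ ⊛ b′) n)) ⟩
  sgn (suc k) · (X e′ ⊛ b′) ∎
  where
  open ≈-Reasoning
  b  = binom m k
  b′ = binom m (suc k)
  e₀ = suc k C 2 + k * suc N
  e  = suc (suc k) C 2 + suc k * N
  e′ = suc (suc k) C 2 + suc k * suc N
  eq : ∀ c x y → -[1+ 0 ] ℤ.* c ℤ.* (x ℤ.+ y) ℤ.+ c ℤ.* x ≡ -[1+ 0 ] ℤ.* c ℤ.* y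
  eq = ℤ-solve
  e-eq : e + suc k ≡ e′
  e-eq = lemma (suc (suc k) C 2) k N
    where
    lemma : ∀ c k N → c + suc k * N + suc k ≡ c + suc k * suc N
    lemma = ℕ-solve
  e₀-eq : suc N + e₀ ≡ e
  e₀-eq = trans (lemma (suc k C 2) k N) (cong (_+ suc k * N) (sym (C2-suc k)))
    where
    lemma : ∀ c k N → suc N + (c + k * suc N) ≡ suc k + c + suc k * N
    lemma = ℕ-solve
  upper : X e ⊛ (b ⊕ X (suc k) ⊛ b′) ≈ X e ⊛ b ⊕ X e′ ⊛ b′
  upper = begin
    X e ⊛ (b ⊕ X (suc k) ⊛ b′)              ≈⟨ R.distribˡ (X e) b (X (suc k) ⊛ b′) ⟩
    X e ⊛ b ⊕ X e ⊛ (X (suc k) ⊛ b′)        ≈⟨ ⊕-congˡ (X e ⊛ b) (R.*-assoc (X e) (X (suc k)) b′) ⟨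
    X e ⊛ b ⊕ X e ⊛ X (suc k) ⊛ b′          ≈⟨ ⊕-congˡ (X e ⊛ b) (⊛-congʳ b′ (X-+ e (suc k))) ⟩
    X e ⊛ b ⊕ X (e + suc k) ⊛ b′            ≡⟨ cong (λ i → X e ⊛ b ⊕ X i ⊛ b′) e-eq ⟩
    X e ⊛ b ⊕ X e′ ⊛ b′                     ∎
  lower : X (suc N) ⊛ (sgn k · (X e₀ ⊛ b)) ≈ sgn k · (X e ⊛ b)
  lower = begin
    X (suc N) ⊛ (sgn k · (X e₀ ⊛ b))   ≈⟨ ⊛-· (sgn k) (X (suc N)) (X e₀ ⊛ b) ⟩
    sgn k · (X (suc N) ⊛ (X e₀ ⊛ b))   ≈⟨ ·-cong (sgn k) (R.*-assoc (X (suc N)) (X e₀) b) ⟨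
    sgn k · (X (suc N) ⊛ X e₀ ⊛ b)     ≈⟨ ·-cong (sgn k) (⊛-congʳ b (X-+ (suc N) e₀)) ⟩
    sgn k · (X (suc N + e₀) ⊛ b)       ≡⟨ cong (λ i → sgn k · (X i ⊛ b)) e₀-eq ⟩
    sgn k · (X e ⊛ b)                  ∎

-- Rests on (q^(N+1);q)_(m+1) + q^(N+1) (q^(N+2);q)_m = (q^(N+2);q)_m; the induction on m needs the
-- case N + 1, so N stays general.
qBinomial : ∀ N m → poch (suc N) 1 m ≈ sumSer (suc m) (qTerm N m)
qBinomial N zero    = mk λ n → sym (trans (ℤₚ.+-identityˡ _)
  (trans (ℤₚ.*-identityˡ _) (at (R.*-identityˡ oneS) n)))
qBinomial N (suc m) = ⊕-cancelʳ (X (suc N) ⊛ P) (begin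
  poch (suc N) 1 (suc m) ⊕ X (suc N) ⊛ P
    ≈⟨ ⊕-cong (poch-front (suc N) 1 m) (R.refl {X (suc N) ⊛ P}) ⟩
  oneMinus (suc N) ⊛ poch (suc N + 1) 1 m ⊕ X (suc N) ⊛ P
    ≡⟨ cong (λ i → oneMinus (suc N) ⊛ poch i 1 m ⊕ X (suc N) ⊛ P) (ℕₚ.+-comm (suc N) 1) ⟩
  oneMinus (suc N) ⊛ P ⊕ X (suc N) ⊛ P
    ≈⟨ ⊕-cong (R.*-comm (oneMinus (suc N)) P) (R.refl {X (suc N) ⊛ P}) ⟩
  P ⊛ oneMinus (suc N) ⊕ X (suc N) ⊛ P
    ≈⟨ ⊛-oneMinus P (suc N) ⟩
  P
    ≈⟨ qBinomial (suc N) m ⟩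
  sumSer (suc m) t′
    ≈⟨ R.+-identityʳ (sumSer (suc m) t′) ⟨
  sumSer (suc m) t′ ⊕ zeroS
    -- A zero term at k = m + 1 gives both sums the same length. Their terms at k = 0 agree by
    -- computation, so `qTerm-step` only has to match the successors.
    ≈⟨ ⊕-congˡ (sumSer (suc m) t′) top ⟨
  sumSer (suc (suc m)) t′
    ≈⟨ sumSer-front (suc m) t′ ⟩
  t′ 0 ⊕ sumSer (suc m) (t′ ∘ suc)
    ≈⟨ ⊕-congˡ (t′ 0) (sumSer-cong (suc m) (qTerm-step N m)) ⟨
  t 0 ⊕ sumSer (suc m) (λ k → t (suc k) ⊕ X (suc N) ⊛ t′ k)
    ≈⟨ ⊕-congˡ (t 0) (sumSer-⊕ (suc m) (t ∘ suc) (λ k → X (suc N) ⊛ t′ k)) ⟩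
  t 0 ⊕ (sumSer (suc m) (t ∘ suc) ⊕ sumSer (suc m) (λ k → X (suc N) ⊛ t′ k))
    ≈⟨ R.+-assoc (t 0) (sumSer (suc m) (t ∘ suc)) (sumSer (suc m) (λ k → X (suc N) ⊛ t′ k)) ⟨
  t 0 ⊕ sumSer (suc m) (t ∘ suc) ⊕ sumSer (suc m) (λ k → X (suc N) ⊛ t′ k)
    ≈⟨ ⊕-cong (sumSer-front (suc m) t) pull ⟨
  sumSer (suc (suc m)) t ⊕ X (suc N) ⊛ P ∎)
  where
  open ≈-Reasoning
  P  = poch (suc (suc N)) 1 m
  t  = qTerm N (suc m)
  t′ = qTerm (suc N) m
  top : t′ (suc m) ≈ zeroS
  top = R.trans (·-cong (sgn (suc m)) (R.trans (⊛-congˡ (X e) (binom-vanish (ℕₚ.n<1+n m))) (R.zeroʳ (X e))))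
                (mk λ _ → ℤₚ.*-zeroʳ (sgn (suc m)))
    where e = suc (suc m) C 2 + suc m * suc N
  pull : X (suc N) ⊛ P ≈ sumSer (suc m) (λ k → X (suc N) ⊛ t′ k)
  pull = begin
    X (suc N) ⊛ P                                 ≈⟨ ⊛-congˡ (X (suc N)) (qBinomial (suc N) m) ⟩
    X (suc N) ⊛ sumSer (suc m) t′                 ≈⟨ R.*-comm (X (suc N)) (sumSer (suc m) t′) ⟩
    sumSer (suc m) t′ ⊛ X (suc N)                 ≈⟨ sumSer-⊛ (suc m) t′ (X (suc N)) ⟩
    sumSer (suc m) (λ k → t′ k ⊛ X (suc N))       ≈⟨ sumSer-cong (suc m) (λ k → R.*-comm (t′ k) (X (suc N))) ⟩
    sumSer (suc m) (λ k → X (suc N) ⊛ t′ k)       ∎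

-- Expansion of p and of the numerator

-- Independent of N: in the expansion of `gauss N m`, N survives only in the power of q in front of
-- `F m k`.
F : ℕ → ℕ → Ser
F m k = binom m k ⊛ invPoch 1 1 m

F-binom : ∀ m k → F m k ⊛ poch 1 1 m ≈ binom m k
F-binom m k = begin
  b ⊛ I ⊛ P    ≈⟨ R.*-assoc b I P ⟩
  b ⊛ (I ⊛ P)  ≈⟨ ⊛-congˡ b (R.trans (R.*-comm I P) (poch-inverse 0 1 m)) ⟩
  b ⊛ oneS     ≈⟨ R.*-identityʳ b ⟩
  b            ∎
  where
  open ≈-Reasoning
  b = binom m k
  I = invPoch 1 1 m
  P = poch 1 1 m

gauss-as-product : ∀ N m → gauss N m ≈ poch (suc N) 1 m ⊛ invPoch 1 1 m
gauss-as-product N m = begin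
  poch 1 1 (N + m) ⊛ I ⊛ J   ≈⟨ ⊛-congʳ J (⊛-congʳ I (poch-+ N m)) ⟩
  Q ⊛ P ⊛ I ⊛ J              ≈⟨ pair-first-last Q P I J ⟩
  (Q ⊛ J) ⊛ (P ⊛ I)          ≈⟨ ⊛-congʳ (P ⊛ I) (poch-inverse 0 1 N) ⟩
  oneS ⊛ (P ⊛ I)             ≈⟨ R.*-identityˡ (P ⊛ I) ⟩
  P ⊛ I                      ∎
  where
  open ≈-Reasoning
  Q = poch 1 1 N
  P = poch (suc N) 1 m
  I = invPoch 1 1 m
  J = invPoch 1 1 N

gauss-expand : ∀ K N m → X K ⊛ gauss N m ≈
  sumSer (suc m) (λ k → sgn k · (X (K + (suc k C 2 + k * N)) ⊛ F m k))
gauss-expand K N m = begin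
  X K ⊛ gauss N m                                     ≈⟨ ⊛-congˡ (X K) (gauss-as-product N m) ⟩
  X K ⊛ (poch (suc N) 1 m ⊛ I)                        ≈⟨ ⊛-congˡ (X K) (⊛-congʳ I (qBinomial N m)) ⟩
  X K ⊛ (sumSer (suc m) (qTerm N m) ⊛ I)              ≈⟨ ∙-left-comm (X K) (sumSer (suc m) (qTerm N m)) I ⟩
  sumSer (suc m) (qTerm N m) ⊛ (X K ⊛ I)              ≈⟨ sumSer-⊛ (suc m) (qTerm N m) (X K ⊛ I) ⟩
  sumSer (suc m) (λ k → qTerm N m k ⊛ (X K ⊛ I))      ≈⟨ sumSer-cong (suc m) step ⟩
  sumSer (suc m) (λ k → sgn k · (X (K + (suc k C 2 + k * N)) ⊛ F m k)) ∎
  where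
  open ≈-Reasoning
  I = invPoch 1 1 m
  step : ∀ k → qTerm N m k ⊛ (X K ⊛ I) ≈ sgn k · (X (K + (suc k C 2 + k * N)) ⊛ F m k)
  step k = begin
    (sgn k · (X e ⊛ b)) ⊛ (X K ⊛ I)    ≈⟨ ·-⊛ (sgn k) (X e ⊛ b) (X K ⊛ I) ⟩
    sgn k · (X e ⊛ b ⊛ (X K ⊛ I))      ≈⟨ ·-cong (sgn k) (∙-exchange (X e) b (X K) I) ⟩
    sgn k · (X K ⊛ X e ⊛ (b ⊛ I))      ≈⟨ ·-cong (sgn k) (⊛-congʳ (b ⊛ I) (X-+ K e)) ⟩
    sgn k · (X (K + e) ⊛ F m k)        ∎
    where
    e = suc k C 2 + k * N
    b = binom m k

-- Trades the integer subtraction for a factor q^K: negative arguments, where `p` is 0 by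
-- definition, become the coefficients below degree K.
p-shift : ∀ A K m N → p (+ A -ℤ + K) m N ≡ (X K ⊛ gauss N m) A
p-shift A K m N = go A K (below-or-shift K A)
  where
  go : ∀ A K → A < K ⊎ (∃ λ d → A ≡ K + d) → p (+ A -ℤ + K) m N ≡ (X K ⊛ gauss N m) A
  go .(K + d) K (inj₂ (d , refl)) = trans
    (cong (λ i → p i m N) (trans (ℤₚ.m-n≡m⊖n (K + d) K)
       (trans (ℤₚ.⊖-≥ (ℕₚ.m≤m+n K d)) (cong +_ (ℕₚ.m+n∸m≡n K d)))))
    (sym (X-shift K (gauss N m) d))
  go A K (inj₁ A<K) with ℕₚ.m≤n⇒∃[o]m+o≡n A<K
  ... | d , refl = trans
    (cong (λ i → p i m N) (trans (ℤₚ.m-n≡m⊖n A K) (trans (ℤₚ.⊖-< A<K)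
       (cong (λ i → ℤ.- (+ i)) (trans (cong (_∸ A) (sym (ℕₚ.+-suc A d))) (ℕₚ.m+n∸m≡n A (suc d)))))))
    (sym (X-below K (gauss N m) A A<K))

sumTo-truncate : ∀ n l f → (∀ k → n ≤ k → f k ≡ + 0) → sumTo (n + l) f ≡ sumTo n f
sumTo-truncate n zero    f f≡0 = cong (λ i → sumTo i f) (ℕₚ.+-identityʳ n)
sumTo-truncate n (suc l) f f≡0 = trans (cong (λ i → sumTo i f) (ℕₚ.+-suc n l))
  (trans (cong₂ ℤ._+_ (sumTo-truncate n l f f≡0) (f≡0 (n + l) (ℕₚ.m≤m+n n l))) (ℤₚ.+-identityʳ _))

-- The q-binomial expansion runs upwards in k while the numerator runs upwards in j = M - k.
sumTo-reverse : ∀ n f → sumTo (suc n) f ≡ sumTo (suc n) (λ i → f (n ∸ i))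
sumTo-reverse zero    f = refl
sumTo-reverse (suc n) f = begin
  sumTo (suc n) f ℤ.+ f (suc n)                       ≡⟨ cong (ℤ._+ f (suc n)) (sumTo-reverse n f) ⟩
  sumTo (suc n) (λ i → f (n ∸ i)) ℤ.+ f (suc n)       ≡⟨ ℤₚ.+-comm _ (f (suc n)) ⟩
  f (suc n) ℤ.+ sumTo (suc n) (λ i → f (n ∸ i))       ≡⟨ sumTo-front (suc n) (λ i → f (suc n ∸ i)) ⟨
  sumTo (suc (suc n)) (λ i → f (suc n ∸ i))           ∎
  where open ≡-Reasoning

-- Makes the natural-number division in the exponents of `NumO` exact.
odd∣B : ∀ M i → i < M → suc (2 * i) ∣ B M
odd∣B (suc M) i (s≤s i≤M) with i ≟ M
... | yes refl = n∣lcm[m,n] (B M) (suc (2 * M))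
... | no  i≢M  = ∣-trans (odd∣B M i (ℕₚ.≤∧≢⇒< i≤M i≢M)) (m∣lcm[m,n] (B M) (suc (2 * M)))

1-z²-over-1-z : oneMinus 2 ⊛ invOneMinus 1 ≈ oneS ⊕ X 1
1-z²-over-1-z = begin
  oneMinus 2 ⊛ v                         ≈⟨ ⊛-congʳ v (oneMinus-+ 1 1) ⟩
  (u ⊕ X 1 ⊛ u) ⊛ v                      ≈⟨ one-plus-factor u (X 1) v ⟩
  u ⊛ v ⊕ X 1 ⊛ (u ⊛ v)                  ≈⟨ ⊕-cong (oneMinus-inverse 0) (⊛-congˡ (X 1) (oneMinus-inverse 0)) ⟩
  oneS ⊕ X 1 ⊛ oneS                      ≈⟨ ⊕-congˡ oneS (R.*-identityʳ (X 1)) ⟩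
  oneS ⊕ X 1                             ∎
  where
  open ≈-Reasoning
  u = oneMinus 1
  v = invOneMinus 1

numeratorTerm : (o D t : ℕ) → Ser → Ser
numeratorTerm o D t g =
  X t ⊛ oneMinus o ⊛ poch (2 * o) (2 * o) D ⊛ invOneMinus 1 ⊛ invPoch 4 2 D ⊛ atPow 2 g

-- Factors in z^o leave the section as factors in z and cancel both denominators, while `X e` enters
-- it as `X (suc s * e)`. There it must combine with `X t` to an even power, so that the monomial
-- passes through `atPow 2` as `X T`; then `atPow2-half`, read at the index `suc s * N`, produces
-- the floor.
section-floor : ∀ s D e t T f g → f ⊛ poch 1 1 (suc D) ≈ g → suc s * e + t ≡ 2 * T →
  X e ⊛ S (suc s) (numeratorTerm (suc s) D t g) ⊛ invOneMinus 1 ⊛ invPoch 2 2 D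
    ≈ λ N → (X T ⊛ f) ((suc s * N) / 2)
section-floor s D e t T f g f-g exponents =
  R.trans left (R.trans (S-cong (suc s) right) (mk λ N → atPow2-half (X T ⊛ f) (suc s * N)))
  where
  open ≈-Reasoning
  P₂ = poch 2 2 D
  P₄ = poch 4 2 D
  I₄ = invPoch 4 2 D
  P  = poch (2 * suc s) (2 * suc s) D
  -- The part of the term that stays inside the section.
  W  = X t ⊛ invOneMinus 1 ⊛ I₄ ⊛ atPow 2 g
  A  = atPow 2 f

  dilated : S (suc s) (numeratorTerm (suc s) D t g) ≈ S (suc s) W ⊛ oneMinus 1 ⊛ P₂
  dilated = begin
    S (suc s) (X t ⊛ oneMinus (suc s) ⊛ P ⊛ invOneMinus 1 ⊛ I₄ ⊛ atPow 2 g)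
      ≈⟨ S-cong (suc s) (dilated-factors-last (X t) (oneMinus (suc s)) P (invOneMinus 1) I₄ (atPow 2 g)) ⟩
    S (suc s) (W ⊛ oneMinus (suc s) ⊛ poch (2 * suc s) (2 * suc s) D)
      ≡⟨ cong₂ (λ i j → S (suc s) (W ⊛ oneMinus i ⊛ poch j j D)) (ℕₚ.*-identityʳ (suc s)) (ℕₚ.*-comm (suc s) 2) ⟨
    S (suc s) (W ⊛ oneMinus (suc s * 1) ⊛ poch (suc s * 2) (suc s * 2) D)
      ≈⟨ S-Dilation.T-poch s (W ⊛ oneMinus (suc s * 1)) 2 2 D ⟩
    S (suc s) (W ⊛ oneMinus (suc s * 1)) ⊛ P₂
      ≈⟨ ⊛-congʳ P₂ (S-Dilation.T-oneMinus s W 1) ⟩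
    S (suc s) W ⊛ oneMinus 1 ⊛ P₂ ∎

  left : X e ⊛ S (suc s) (numeratorTerm (suc s) D t g) ⊛ invOneMinus 1 ⊛ invPoch 2 2 D ≈ S (suc s) (X (suc s * e) ⊛ W)
  left = begin
    X e ⊛ S (suc s) (numeratorTerm (suc s) D t g) ⊛ invOneMinus 1 ⊛ invPoch 2 2 D
      ≈⟨ ⊛-congʳ (invPoch 2 2 D) (⊛-congʳ (invOneMinus 1) (⊛-congˡ (X e) dilated)) ⟩
    X e ⊛ (S (suc s) W ⊛ oneMinus 1 ⊛ P₂) ⊛ invOneMinus 1 ⊛ invPoch 2 2 D
      ≈⟨ pair-inverses (X e) (S (suc s) W) (oneMinus 1) P₂ (invOneMinus 1) (invPoch 2 2 D) ⟩
    (oneMinus 1 ⊛ invOneMinus 1) ⊛ ((P₂ ⊛ invPoch 2 2 D) ⊛ (X e ⊛ S (suc s) W))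
      ≈⟨ ⊛-cong (oneMinus-inverse 0) (⊛-congʳ (X e ⊛ S (suc s) W) (poch-inverse 1 2 D)) ⟩
    oneS ⊛ (oneS ⊛ (X e ⊛ S (suc s) W))
      ≈⟨ R.trans (R.*-identityˡ (oneS ⊛ (X e ⊛ S (suc s) W))) (R.*-identityˡ (X e ⊛ S (suc s) W)) ⟩
    X e ⊛ S (suc s) W
      ≈⟨ S-X s e W ⟨
    S (suc s) (X (suc s * e) ⊛ W) ∎

  atPow-g : atPow 2 g ≈ A ⊛ (oneMinus 2 ⊛ P₄)
  atPow-g = begin
    atPow 2 g                              ≈⟨ atPow-cong 2 f-g ⟨
    atPow 2 (f ⊛ poch 1 1 (suc D))         ≈⟨ atPow-Dilation.T-poch 1 f 1 1 (suc D) ⟩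
    A ⊛ poch 2 2 (suc D)                   ≈⟨ ⊛-congˡ A (poch-front 2 2 D) ⟩
    A ⊛ (oneMinus 2 ⊛ P₄)                  ∎

  right : X (suc s * e) ⊛ W ≈ (oneS ⊕ X 1) ⊛ atPow 2 (X T ⊛ f)
  right = begin
    X (suc s * e) ⊛ (X t ⊛ invOneMinus 1 ⊛ I₄ ⊛ atPow 2 g)
      ≈⟨ ⊛-congˡ (X (suc s * e)) (⊛-congˡ (X t ⊛ invOneMinus 1 ⊛ I₄) atPow-g) ⟩
    X (suc s * e) ⊛ (X t ⊛ invOneMinus 1 ⊛ I₄ ⊛ (A ⊛ (oneMinus 2 ⊛ P₄)))
      ≈⟨ ⊛-congˡ (X (suc s * e)) (pair-inverses′ (X t) (invOneMinus 1) I₄ A (oneMinus 2) P₄) ⟩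
    X (suc s * e) ⊛ ((P₄ ⊛ I₄) ⊛ ((oneMinus 2 ⊛ invOneMinus 1) ⊛ (X t ⊛ A)))
      ≈⟨ ⊛-congˡ (X (suc s * e)) (⊛-cong (poch-inverse 3 2 D) (⊛-congʳ (X t ⊛ A) 1-z²-over-1-z)) ⟩
    X (suc s * e) ⊛ (oneS ⊛ ((oneS ⊕ X 1) ⊛ (X t ⊛ A)))
      ≈⟨ ⊛-congˡ (X (suc s * e)) (R.*-identityˡ ((oneS ⊕ X 1) ⊛ (X t ⊛ A))) ⟩
    X (suc s * e) ⊛ ((oneS ⊕ X 1) ⊛ (X t ⊛ A))
      ≈⟨ move-into (X (suc s * e)) (oneS ⊕ X 1) (X t) A ⟩
    (oneS ⊕ X 1) ⊛ (X (suc s * e) ⊛ X t ⊛ A)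
      ≈⟨ ⊛-congˡ (oneS ⊕ X 1) (⊛-congʳ A (X-+ (suc s * e) t)) ⟩
    (oneS ⊕ X 1) ⊛ (X (suc s * e + t) ⊛ A)
      ≡⟨ cong (λ i → (oneS ⊕ X 1) ⊛ (X i ⊛ A)) exponents ⟩
    (oneS ⊕ X 1) ⊛ (X (2 * T) ⊛ A)
      ≈⟨ ⊛-congˡ (oneS ⊕ X 1) (atPow-X 1 T f) ⟨
    (oneS ⊕ X 1) ⊛ atPow 2 (X T ⊛ f) ∎

-- Comparison of the two expansions term by term

summand : (K N m A k : ℕ) → ℤ
summand K N m A k = sgn k ℤ.* (X (K + (suc k C 2 + k * N)) ⊛ F m k) A

p-expand : ∀ A K m N → p (+ A -ℤ + K) m N ≡ sumTo (suc m) (summand K N m A)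
p-expand A K m N = trans (p-shift A K m N) (trans (at (gauss-expand K N m) A)
  (sumSer-at (suc m) (λ k → sgn k · (X (K + (suc k C 2 + k * N)) ⊛ F m k)) A))

-- The product `suc k * N` alone may equal the floor, for instance at N = 0. Strictness comes from
-- C(k+2,2) > 0, hence the successor index.
summand-vanish : ∀ K N m k → m ≤ 2 * suc k → summand K N m ((m * N) / 2) (suc k) ≡ + 0
summand-vanish K N m k m≤2k = trans
  (cong (sgn (suc k) ℤ.*_) (X-below _ (F m (suc k)) _ (begin-strict
    (m * N) / 2                                      ≤⟨ DivMod./-monoˡ-≤ 2 (ℕₚ.*-monoˡ-≤ N m≤2k) ⟩
    (2 * suc k * N) / 2                              ≡⟨ cong (_/ 2) (eq k N) ⟩
    (suc k * N * 2) / 2                              ≡⟨ DivMod.m*n/n≡m (suc k * N) 2 ⟩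
    suc k * N                                        <⟨ ℕₚ.m<n+m (suc k * N) (ℕₚ.≤-trans (s≤s z≤n) (ℕₚ.≤-reflexive (sym (C2-suc k)))) ⟩
    suc (suc k) C 2 + suc k * N                      ≤⟨ ℕₚ.m≤n+m _ K ⟩
    K + (suc (suc k) C 2 + suc k * N)                ∎)))
  (ℤₚ.*-zeroʳ (sgn (suc k)))
  where
  open ℕₚ.≤-Reasoning
  eq : ∀ k N → 2 * suc k * N ≡ suc k * N * 2
  eq = ℕ-solve

-- `k * N` splits off the floor as an integer and cancels the same amount in the exponent, leaving a
-- shift free of N.
summand-floor : ∀ K N m o k → m ≡ o + k * 2 →
  summand K N m ((m * N) / 2) k ≡ sgn k ℤ.* (X (K + suc k C 2) ⊛ F m k) ((o * N) / 2)
summand-floor K N m o k m≡ = cong (sgn k ℤ.*_) (trans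
  (cong₂ (λ e A → (X e ⊛ F m k) A) (eq₁ K (suc k C 2) (k * N)) floor)
  (X-shift-+ (K + suc k C 2) (k * N) (F m k) ((o * N) / 2)))
  where
  open ≡-Reasoning
  eq₁ : ∀ K c x → K + (c + x) ≡ x + (K + c)
  eq₁ = ℕ-solve
  eq₂ : ∀ o k N → (o + k * 2) * N ≡ k * N * 2 + o * N
  eq₂ = ℕ-solve
  floor : (m * N) / 2 ≡ k * N + (o * N) / 2
  floor = begin
    (m * N) / 2                      ≡⟨ cong (λ i → (i * N) / 2) m≡ ⟩
    ((o + k * 2) * N) / 2            ≡⟨ cong (_/ 2) (eq₂ o k N) ⟩
    (k * N * 2 + o * N) / 2          ≡⟨ DivMod.+-distrib-/-∣ˡ (o * N) {d = 2} (n∣m*n (k * N)) ⟩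
    (k * N * 2) / 2 + (o * N) / 2    ≡⟨ cong (_+ (o * N) / 2) (DivMod.m*n/n≡m (k * N) 2) ⟩
    k * N + (o * N) / 2              ∎

sumSer-⊛-⊛ : ∀ n (c : ℕ → ℤ) (f : ℕ → Ser) v w →
  sumSer n (λ i → c i · f i) ⊛ v ⊛ w ≈ sumSer n (λ i → c i · (f i ⊛ v ⊛ w))
sumSer-⊛-⊛ n c f v w = begin
  sumSer n (λ i → c i · f i) ⊛ v ⊛ w          ≈⟨ R.*-assoc (sumSer n (λ i → c i · f i)) v w ⟩
  sumSer n (λ i → c i · f i) ⊛ (v ⊛ w)        ≈⟨ sumSer-⊛ n (λ i → c i · f i) (v ⊛ w) ⟩
  sumSer n (λ i → (c i · f i) ⊛ (v ⊛ w))      ≈⟨ sumSer-cong n (λ i → ·-⊛ (c i) (f i) (v ⊛ w)) ⟩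
  sumSer n (λ i → c i · (f i ⊛ (v ⊛ w)))      ≈⟨ sumSer-cong n (λ i → ·-cong (c i) (R.*-assoc (f i) v w)) ⟨
  sumSer n (λ i → c i · (f i ⊛ v ⊛ w))        ∎
  where open ≈-Reasoning

sumSer-⊛-at : ∀ n (c : ℕ → ℤ) (f : ℕ → Ser) v w N →
  (sumSer n (λ i → c i · f i) ⊛ v ⊛ w) N ≡ sumTo n (λ i → c i ℤ.* (f i ⊛ v ⊛ w) N)
sumSer-⊛-at n c f v w N =
  trans (at (sumSer-⊛-⊛ n c f v w) N) (sumSer-at n (λ i → c i · (f i ⊛ v ⊛ w)) N)

numeratorSummand : (M a r i : ℕ) → Ser
numeratorSummand M a r i =
  X ((2 * B M * a) / suc (2 * i)) ⊛
  S (suc (2 * i)) (numeratorTerm (suc (2 * i)) (2 * M ∸ 2) (2 * r + 2 * ((M ∸ suc i + 1) C 2))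
    (gauss (M + suc i ∸ 1) (M ∸ suc i)))

NumO-summands : ∀ M a r → NumO M a r ≡ sumSer M (λ i → sgn (M ∸ suc i) · numeratorSummand M a r i)
NumO-summands M a r = refl

-- The instance o = 2i + 1, k = M - i of `section-floor`, with M + 1 as the number of summands. The
-- exponents fit because o divides `B (suc M)`, so o times the quotient is exactly
-- `2 * B (suc M) * a`.
numeratorSummand-floor : ∀ M a r i → i ≤ M →
  numeratorSummand (suc M) a r i ⊛ invOneMinus 1 ⊛ invPoch 2 2 (2 * suc M ∸ 2)
    ≈ λ N → (X (B (suc M) * a + r + suc (M ∸ i) C 2) ⊛ F (2 * suc M ∸ 1) (M ∸ i)) ((suc (2 * i) * N) / 2)
numeratorSummand-floor M a r i i≤M = R.trans
  (⊛-congʳ (invPoch 2 2 (2 * suc M ∸ 2)) (⊛-congʳ (invOneMinus 1) (R.reflexive unfolded)))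
  (section-floor (2 * i) (2 * suc M ∸ 2) ((2 * B (suc M) * a) / suc (2 * i)) (2 * r + 2 * ((M ∸ i + 1) C 2))
    (B (suc M) * a + r + suc (M ∸ i) C 2) (F (2 * suc M ∸ 1) (M ∸ i)) (gauss (M + suc i) (M ∸ i)) F-g exponents)
  where
  open ≡-Reasoning
  k = M ∸ i
  -- Unfolding inside the coefficients of the surrounding products is very slow, so it is done on the bare series.
  unfolded : numeratorSummand (suc M) a r i ≡ X ((2 * B (suc M) * a) / suc (2 * i)) ⊛
    S (suc (2 * i)) (numeratorTerm (suc (2 * i)) (2 * suc M ∸ 2) (2 * r + 2 * ((M ∸ i + 1) C 2)) (gauss (M + suc i) (M ∸ i)))
  unfolded = refl
  -- The number of parts is needed in two further shapes: as a successor for the q-factorial in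
  -- `section-floor`, and as a sum for `binom-gauss`.
  m≡1+D : 2 * suc M ∸ 1 ≡ suc (2 * suc M ∸ 2)
  m≡1+D = trans (ℕₚ.+-suc M (M + 0)) (cong (suc ∘ (_∸ 1)) (sym (ℕₚ.+-suc M (M + 0))))
  m≡a+b : 2 * suc M ∸ 1 ≡ M + suc i + k
  m≡a+b = begin
    M + suc (M + 0)          ≡⟨ cong (λ x → M + suc (x + 0)) (ℕₚ.m+[n∸m]≡n i≤M) ⟨
    M + suc (i + k + 0)      ≡⟨ lemma M i k ⟩
    M + suc i + k            ∎
    where
    lemma : ∀ M i k → M + suc (i + k + 0) ≡ M + suc i + k
    lemma = ℕ-solve
  F-g : F (2 * suc M ∸ 1) k ⊛ poch 1 1 (suc (2 * suc M ∸ 2)) ≈ gauss (M + suc i) k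
  F-g = R.trans (subst (λ x → F (2 * suc M ∸ 1) k ⊛ poch 1 1 x ≈ binom (2 * suc M ∸ 1) k) m≡1+D (F-binom (2 * suc M ∸ 1) k))
                (subst (λ x → binom x k ≈ gauss (M + suc i) k) (sym m≡a+b) (binom-gauss (M + suc i) k))
  exponents : suc (2 * i) * ((2 * B (suc M) * a) / suc (2 * i)) + (2 * r + 2 * ((k + 1) C 2))
            ≡ 2 * (B (suc M) * a + r + suc k C 2)
  exponents = begin
    suc (2 * i) * ((2 * B (suc M) * a) / suc (2 * i)) + (2 * r + 2 * ((k + 1) C 2))
      ≡⟨ cong₂ (λ x y → x + (2 * r + 2 * (y C 2)))
           (DivMod.m*[n/m]≡n (∣m⇒∣m*n a (∣n⇒∣m*n 2 (odd∣B (suc M) i (s≤s i≤M))))) (ℕₚ.+-comm k 1) ⟩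
    2 * B (suc M) * a + (2 * r + 2 * (suc k C 2))
      ≡⟨ lemma (B (suc M)) a r (suc k C 2) ⟩
    2 * (B (suc M) * a + r + suc k C 2) ∎
    where
    lemma : ∀ b a r c → 2 * b * a + (2 * r + 2 * c) ≡ 2 * (b * a + r + c)
    lemma = ℕ-solve

NumO-at : ∀ M a r N → (NumO M a r ⊛ invOneMinus 1 ⊛ invPoch 2 2 (2 * M ∸ 2)) N ≡
  sumTo M (λ i → sgn (M ∸ suc i) ℤ.*
    (numeratorSummand M a r i ⊛ invOneMinus 1 ⊛ invPoch 2 2 (2 * M ∸ 2)) N)
NumO-at M a r N = trans
  (cong (λ f → (f ⊛ invOneMinus 1 ⊛ invPoch 2 2 (2 * M ∸ 2)) N) (NumO-summands M a r))
  (sumSer-⊛-at M (λ i → sgn (M ∸ suc i)) (numeratorSummand M a r) (invOneMinus 1) (invPoch 2 2 (2 * M ∸ 2)) N)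

theorem2p4 : (M : ℕ) → 1 ≤ M → (a r : ℕ) → (N : ℕ) →
    p (+ (((2 * M ∸ 1) * N) / 2) -ℤ + (B M * a + r)) (2 * M ∸ 1) N
    ≡ (NumO M a r ⊛ invOneMinus 1 ⊛ invPoch 2 2 (2 * M ∸ 2)) N
theorem2p4 M@(suc M′) _ a r N = begin
  p (+ ((m * N) / 2) -ℤ + K) m N              ≡⟨ p-expand ((m * N) / 2) K m N ⟩
  -- The indices 0, ..., m number 2M: the lower half survives, and the upper half has 2k > m.
  sumTo (suc m) f                             ≡⟨ cong (λ i → sumTo i f) (trans (cong suc m-eq) (eq₁ M′)) ⟩
  sumTo (M + M) f                             ≡⟨ sumTo-truncate M M f vanish ⟩
  sumTo M f                                   ≡⟨ sumTo-reverse M′ f ⟩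
  sumTo M (λ i → f (M′ ∸ i))                  ≡⟨ sumTo-cong M term ⟩
  sumTo M (λ i → sgn (M ∸ suc i) ℤ.*
    (numeratorSummand M a r i ⊛ invOneMinus 1 ⊛ invPoch 2 2 (2 * M ∸ 2)) N)
                                              ≡⟨ NumO-at M a r N ⟨
  (NumO M a r ⊛ invOneMinus 1 ⊛ invPoch 2 2 (2 * M ∸ 2)) N ∎
  where
  open ≡-Reasoning
  m = 2 * M ∸ 1
  K = B M * a + r
  f = summand K N m ((m * N) / 2)
  m-eq : m ≡ suc (2 * M′)
  m-eq = ℕₚ.+-suc M′ (M′ + 0)
  eq₁ : ∀ M → suc (suc (2 * M)) ≡ suc M + suc M
  eq₁ = ℕ-solve

  -- M is a successor, so k = 0 cannot occur and `summand-vanish` applies to every remaining k.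
  vanish : ∀ k → M ≤ k → f k ≡ + 0
  vanish (suc k) M≤k = summand-vanish K N m k (ℕₚ.≤-trans (ℕₚ.m∸n≤m (2 * M) 1) (ℕₚ.*-monoʳ-≤ 2 M≤k))

  term : ∀ i → i < M → f (M′ ∸ i) ≡ sgn (M ∸ suc i) ℤ.*
    (numeratorSummand M a r i ⊛ invOneMinus 1 ⊛ invPoch 2 2 (2 * M ∸ 2)) N
  term i (s≤s i≤M′) = trans
    (summand-floor K N m (suc (2 * i)) (M′ ∸ i) m≡o+2k)
    (cong (sgn (M′ ∸ i) ℤ.*_) (sym (at (numeratorSummand-floor M′ a r i i≤M′) N)))
    where
    lemma : ∀ i k → suc (2 * (i + k)) ≡ suc (2 * i) + k * 2
    lemma = ℕ-solve
    m≡o+2k : m ≡ suc (2 * i) + (M′ ∸ i) * 2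
    m≡o+2k = trans m-eq (trans (cong (λ x → suc (2 * x)) (sym (ℕₚ.m+[n∸m]≡n i≤M′))) (lemma i (M′ ∸ i)))
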